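{- Fix $k\geq 2$ and suppose that $\Gamma$ is a computable embedding witnessing $\{\omega\cdot k,\ \omega^\star\cdot k\}\leq_c\{\mathcal{D}_0,\mathcal{D}_1\}$, where $\mathcal{D}_0$ is a linear order without infinite descending chains and $\mathcal{D}_1$ is an infinite linear order without infinite ascending chains. Then $\mathcal{D}_0$ contains a suborder isomorphic to $\omega\cdot k$ and $\mathcal{D}_1$ contains a suborder isomorphic to $\omega^\star\cdot k$.
   Context: Structures have domains contained in $\omega$ and are in the language of linear orders; a class is identified with all isomorphic copies of its members. An enumeration operator $\Gamma$ is a c.e. set of pairs $(\alpha,\varphi)$ with $\alpha$ a finite set of basic sentences with constants from $\omega$ and $\varphi$ a basic sentence with constants from $\omega$; $\Gamma(\mathcal{S})=\{\varphi:(\alpha,\varphi)\in\Gamma,\ \alpha\subseteq D(\mathcal{S})\}$, $D(\mathcal{S})$ the atomic diagram. $\Gamma$ witnesses $\{\mathcal{A},\mathcal{B}\}\leq_c\{\mathcal{C},\mathcal{D}\}$ (for non-isomorphic $\mathcal{A},\mathcal{B}$) if for every copy $\hat{\mathcal{A}}$ of $\mathcal{A}$, $\Gamma(\hat{\mathcal{A}})$ is the atomic diagram of a copy of $\mathcal{C}$, and for every copy $\hat{\mathcal{B}}$ of $\mathcal{B}$, $\Gamma(\hat{\mathcal{B}})$ is the atomic diagram of a copy of $\mathcal{D}$. $\omega\cdot k$ is the order type of $k$ copies of $\omega$ placed one after another; $\omega^\star\cdot k$ is that of $k$ copies of $\omega^\star$ (the reverse of $\omega$). -}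

module Defs where

open import Level using (0ℓ) renaming (suc to lsuc)
open import Data.Nat using (ℕ; _≤_; _<_)
open import Data.Fin using (Fin) renaming (_<_ to _<ᶠ_)
open import Data.Maybe using (Maybe; just)
open import Data.List using (List)
open import Data.List.Membership.Propositional using (_∈_)
open import Data.List.Relation.Unary.All using (All)
open import Data.Product using (Σ; ∃; _×_; _,_)
open import Data.Sum using (_⊎_)
open import Relation.Nullary using (¬_)
open import Relation.Binary.PropositionalEquality using (_≡_; _≢_)
open import Function.Bundles using (_⇔_)

record OrdStr : Set₁ where
  field
    Carrier : Set
    _≼_     : Carrier → Carrier → Set
open OrdStr public

record IsLinearOrder (L : OrdStr) : Set where
  field
    reflexive : ∀ (x : Carrier L) → _≼_ L x x
    trans     : ∀ {x y z : Carrier L} → _≼_ L x y → _≼_ L y z → _≼_ L x z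
    antisym   : ∀ {x y : Carrier L} → _≼_ L x y → _≼_ L y x → x ≡ y
    total     : ∀ (x y : Carrier L) → (_≼_ L x y) ⊎ (_≼_ L y x)

NoInfDesc : OrdStr → Set
NoInfDesc L = ¬ (Σ (ℕ → Carrier L) λ f → ∀ n → _≼_ L (f (Data.Nat.suc n)) (f n) × f (Data.Nat.suc n) ≢ f n)

NoInfAsc : OrdStr → Set
NoInfAsc L = ¬ (Σ (ℕ → Carrier L) λ f → ∀ n → _≼_ L (f n) (f (Data.Nat.suc n)) × f n ≢ f (Data.Nat.suc n))

Infinite : OrdStr → Set
Infinite L = ¬ (Σ (List (Carrier L)) λ xs → ∀ x → x ∈ xs)

Embeds : OrdStr → OrdStr → Set
Embeds K L = Σ (Carrier K → Carrier L) λ f →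
  ∀ x y → (_≼_ K x y ⇔ _≼_ L (f x) (f y))

ω·_ : ℕ → OrdStr
ω· k = record
  { Carrier = Fin k × ℕ
  ; _≼_ = λ { (i , n) (j , m) → (i <ᶠ j) ⊎ (i ≡ j × n ≤ m) } }

ω*·_ : ℕ → OrdStr
ω*· k = record
  { Carrier = Fin k × ℕ
  ; _≼_ = λ { (i , n) (j , m) → (i <ᶠ j) ⊎ (i ≡ j × m ≤ n) } }

record Copy : Set₁ where
  field
    dom : ℕ → Set
    R   : ℕ → ℕ → Set
open Copy public

record Iso (S : Copy) (L : OrdStr) : Set where
  field
    f    : (n : ℕ) → dom S n → Carrier L
    inj  : ∀ {n m} (p : dom S n) (q : dom S m) → f n p ≡ f m q → n ≡ m
    surj : ∀ c → Σ ℕ λ n → Σ (dom S n) λ p → f n p ≡ c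
    pres : ∀ {n m} (p : dom S n) (q : dom S m) → (R S n m ⇔ _≼_ L (f n p) (f m q))

data Sentence : Set where
  eq neq leq nleq : ℕ → ℕ → Sentence

Diag : Copy → Sentence → Set
Diag S (eq a b)   = dom S a × dom S b × a ≡ b
Diag S (neq a b)  = dom S a × dom S b × a ≢ b
Diag S (leq a b)  = dom S a × dom S b × R S a b
Diag S (nleq a b) = dom S a × dom S b × ¬ R S a b

-- Enumeration operator: a c.e. set of pairs (α , φ), α finite set of
-- basic sentences, given as the range of an (Agda-definable, hence
-- computable) enumeration ℕ → Maybe (pair); `nothing` = nothing enumerated at stage n.
EnumOp : Set
EnumOp = ℕ → Maybe (List Sentence × Sentence)

apply : EnumOp → Copy → Sentence → Set
apply Γ S φ = Σ ℕ λ s → Σ (List Sentence) λ α → (Γ s ≡ just (α , φ)) × All (Diag S) α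

IsDiagOfCopy : (Sentence → Set) → OrdStr → Set₁
IsDiagOfCopy X L = Σ Copy λ C → Iso C L × (∀ φ → X φ ⇔ Diag C φ)

Witnesses : EnumOp → OrdStr → OrdStr → OrdStr → OrdStr → Set₁
Witnesses Γ A B C D =
  (∀ (S : Copy) → Iso S A → IsDiagOfCopy (apply Γ S) C) ×
  (∀ (S : Copy) → Iso S B → IsDiagOfCopy (apply Γ S) D)

{-# OPTIONS --safe #-}
-- Every finite piece of a copy of ω·k or ω*·k can be continued by fresh elements to a
-- copy of ω·k.  Hence, once a finite chain forces two elements into the output of Γ, it
-- fixes their order there: two conditions disagreeing about it would both be compatible
-- with one decision taken above the chain on fresh elements.  As D₁ is infinite, there are
-- pairwise disjoint finite chains B₀, B₁, … forcing distinct outputs x₀, x₁, …; the Bᵢ may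
-- be placed in any order relative to each other.  Placing B₀ < B₁ < … inside a copy of ω·k
-- and using that D₀ is well-founded yields a subsequence along which Bᵢ < Bⱼ implies
-- xᵢ < xⱼ for i < j; placing … < B₁ < B₀ inside a copy of ω*·k and using D₁ yields a further
-- one along which this also holds for i > j.  Along it the order of the outputs copies the
-- order of the chains, which can be arranged in type ω·k or ω*·k.
module Submission where

open import Defs
open import Level using (0ℓ; Lift; lift; lower) renaming (suc to lsuc)
open import Axiom.ExcludedMiddle using (ExcludedMiddle)
open import Data.Nat using (ℕ; zero; suc; _+_; _*_; _∸_; _≤_; _<_; z≤n; s≤s)
open import Data.Nat.Properties
open import Data.Nat.DivMod using (_%_; [m+kn]%n≡m%n; m<n⇒m%n≡m)
open import Data.List.Extrema.Nat using (max; xs≤max)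
open import Data.Fin using (Fin; toℕ) renaming (zero to fzero; suc to fsuc; _<_ to _<ᶠ_)
import Data.Fin.Properties as Fin
open import Data.List using (List; []; _∷_; _++_; map; concatMap; foldr; applyUpTo; length)
open import Data.List.Membership.Propositional using (_∈_)
open import Data.List.Membership.Propositional.Properties
  using (∈-++⁺ˡ; ∈-++⁺ʳ; ∈-map⁺)
open import Data.List.Relation.Unary.All as All using (All; []; _∷_)
import Data.List.Relation.Unary.All.Properties as All
open import Data.List.Relation.Unary.AllPairs as AllPairs using (AllPairs; []; _∷_)
import Data.List.Relation.Unary.AllPairs.Properties as AllPairs
open import Data.List.Relation.Unary.Any using (here; there)
open import Data.List.Relation.Binary.Subset.Propositional using (_⊆_)
open import Data.Product using (∃; _×_; _,_; proj₁; proj₂)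
open import Data.Sum using (_⊎_; inj₁; inj₂; [_,_]′)
open import Data.Empty using (⊥-elim)
open import Relation.Nullary using (¬_; Dec; yes; no; contradiction)
open import Relation.Nullary.Decidable using (map′; decidable-stable)
open import Relation.Binary.Definitions using (tri<; tri≈; tri>)
open import Relation.Binary.PropositionalEquality as ≡ hiding (trans)
open import Function using (_∘_; id)
open import Function.Bundles using (mk⇔; Equivalence)

open Equivalence using (to; from)

-- Linear orders, and lists with pairwise related entries.

Strict : (L : OrdStr) → Carrier L → Carrier L → Set
Strict L x y = _≼_ L x y × x ≢ y

dual : OrdStr → OrdStr
dual L = record { Carrier = Carrier L ; _≼_ = λ x y → _≼_ L y x }

dual-linear : ∀ {L} → IsLinearOrder L → IsLinearOrder (dual L)
dual-linear lin = record
  { reflexive = reflexive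
  ; trans     = λ p q → trans q p
  ; antisym   = λ p q → antisym q p
  ; total     = λ x y → total y x
  } where open IsLinearOrder lin

ω-linear : ∀ k → IsLinearOrder (ω· k)
ω-linear k = record
  { reflexive = λ _ → inj₂ (refl , ≤-refl)
  ; trans     = λ { (inj₁ p) (inj₁ q) → inj₁ (<-trans p q)
                  ; (inj₁ p) (inj₂ (refl , _)) → inj₁ p
                  ; (inj₂ (refl , _)) (inj₁ q) → inj₁ q
                  ; (inj₂ (refl , p)) (inj₂ (refl , q)) → inj₂ (refl , ≤-trans p q) }
  ; antisym   = λ { (inj₁ p) (inj₁ q) → ⊥-elim (<-asym p q)
                  ; (inj₁ p) (inj₂ (refl , _)) → ⊥-elim (<-irrefl refl p)
                  ; (inj₂ (refl , _)) (inj₁ q) → ⊥-elim (<-irrefl refl q)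
                  ; (inj₂ (refl , p)) (inj₂ (_ , q)) → cong (_ ,_) (≤-antisym p q) }
  ; total     = total
  }
  where
  total : (x y : Fin k × ℕ) → _≼_ (ω· k) x y ⊎ _≼_ (ω· k) y x
  total (i , n) (j , m) with Fin.<-cmp i j | ≤-total n m
  ... | tri< p _ _    | _      = inj₁ (inj₁ p)
  ... | tri> _ _ p    | _      = inj₂ (inj₁ p)
  ... | tri≈ _ refl _ | inj₁ p = inj₁ (inj₂ (refl , p))
  ... | tri≈ _ refl _ | inj₂ p = inj₂ (inj₂ (refl , p))

ω*-linear : ∀ k → IsLinearOrder (ω*· k)
ω*-linear k = record
  { reflexive = λ _ → inj₂ (refl , ≤-refl)
  ; trans     = λ { (inj₁ p) (inj₁ q) → inj₁ (<-trans p q)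
                  ; (inj₁ p) (inj₂ (refl , _)) → inj₁ p
                  ; (inj₂ (refl , _)) (inj₁ q) → inj₁ q
                  ; (inj₂ (refl , p)) (inj₂ (refl , q)) → inj₂ (refl , ≤-trans q p) }
  ; antisym   = λ { (inj₁ p) (inj₁ q) → ⊥-elim (<-asym p q)
                  ; (inj₁ p) (inj₂ (refl , _)) → ⊥-elim (<-irrefl refl p)
                  ; (inj₂ (refl , _)) (inj₁ q) → ⊥-elim (<-irrefl refl q)
                  ; (inj₂ (refl , p)) (inj₂ (_ , q)) → cong (_ ,_) (≤-antisym q p) }
  ; total     = total
  }
  where
  total : (x y : Fin k × ℕ) → _≼_ (ω*· k) x y ⊎ _≼_ (ω*· k) y x
  total (i , n) (j , m) with Fin.<-cmp i j | ≤-total n m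
  ... | tri< p _ _    | _      = inj₁ (inj₁ p)
  ... | tri> _ _ p    | _      = inj₂ (inj₁ p)
  ... | tri≈ _ refl _ | inj₁ p = inj₂ (inj₂ (refl , p))
  ... | tri≈ _ refl _ | inj₂ p = inj₁ (inj₂ (refl , p))

AllPairs-compare : ∀ {A : Set} {P : A → A → Set} {l a b} →
  AllPairs P l → a ∈ l → b ∈ l → a ≡ b ⊎ P a b ⊎ P b a
AllPairs-compare (_ ∷ _) (here refl) (here refl) = inj₁ refl
AllPairs-compare (p ∷ _) (here refl) (there q)   = inj₂ (inj₁ (All.lookup p q))
AllPairs-compare (p ∷ _) (there q)   (here refl) = inj₂ (inj₂ (All.lookup p q))
AllPairs-compare (_ ∷ p) (there q)   (there r)   = AllPairs-compare p q r

AllPairs-mapWith∈ : ∀ {A : Set} {P Q : A → A → Set} {l} →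
  (∀ {a b} → a ∈ l → b ∈ l → P a b → Q a b) → AllPairs P l → AllPairs Q l
AllPairs-mapWith∈ h []       = []
AllPairs-mapWith∈ h (p ∷ ps) =
  All.tabulate (λ b∈ → h (here refl) (there b∈) (All.lookup p b∈)) ∷
  AllPairs-mapWith∈ (λ a∈ b∈ → h (there a∈) (there b∈)) ps

-- Transfer of basic sentences between copies of linear orders.

record LinearCopy (S : Copy) : Set where
  field
    total   : ∀ {a b} → dom S a → dom S b → R S a b ⊎ R S b a
    antisym : ∀ {a b} → dom S a → dom S b → R S a b → R S b a → a ≡ b

  reflexive : ∀ {a} → dom S a → R S a a
  reflexive p = [ id , id ]′ (total p p)
open LinearCopy

linearCopy : ∀ {S L} → IsLinearOrder L → Iso S L → LinearCopy S
linearCopy lin iso = record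
  { total   = λ p q → [ inj₁ ∘ from (pres p q) , inj₂ ∘ from (pres q p) ]′
                        (IsLinearOrder.total lin _ _)
  ; antisym = λ p q r s →
      inj p q (IsLinearOrder.antisym lin (to (pres p q) r) (to (pres q p) s))
  } where open Iso iso

-- The two relations are recorded with the same orientation, so that agreement is
-- symmetric and carries over negative sentences as well.
SameOrder : Copy → Copy → ℕ → ℕ → Set
SameOrder S T a b = (R S a b × R T a b) ⊎ (R S b a × R T b a)

numbers : Sentence → List ℕ
numbers (eq a b)   = a ∷ b ∷ []
numbers (neq a b)  = a ∷ b ∷ []
numbers (leq a b)  = a ∷ b ∷ []
numbers (nleq a b) = a ∷ b ∷ []

Diag-dom : ∀ {S} φ → Diag S φ → All (dom S) (numbers φ)
Diag-dom (eq a b)   (p , q , _) = p ∷ q ∷ []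
Diag-dom (neq a b)  (p , q , _) = p ∷ q ∷ []
Diag-dom (leq a b)  (p , q , _) = p ∷ q ∷ []
Diag-dom (nleq a b) (p , q , _) = p ∷ q ∷ []

Diag-dom-All : ∀ {S α} → All (Diag S) α → All (dom S) (concatMap numbers α)
Diag-dom-All                 []       = []
Diag-dom-All {α = φ ∷ _} (d ∷ ds) = All.++⁺ (Diag-dom φ d) (Diag-dom-All ds)

module _ {S T : Copy} (linS : LinearCopy S) (linT : LinearCopy T)
         {U : ℕ → Set} (U⇒T : ∀ {a} → U a → dom T a)
         (same : ∀ {a b} → U a → U b → SameOrder S T a b) where

  -- Each pair has an orientation that holds in both copies. A relation holding against it forces
  -- equality by antisymmetry, so `leq` and `nleq` both carry over.
  Diag-transfer : ∀ φ → All U (numbers φ) → Diag S φ → Diag T φ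
  Diag-transfer (eq a b)  (u ∷ v ∷ []) (_ , _ , r) = U⇒T u , U⇒T v , r
  Diag-transfer (neq a b) (u ∷ v ∷ []) (_ , _ , r) = U⇒T u , U⇒T v , r
  Diag-transfer (leq a b) (u ∷ v ∷ []) (p , q , r) = U⇒T u , U⇒T v , r′ (same u v)
    where
    r′ : SameOrder S T a b → R T a b
    r′ (inj₁ (_ , t)) = t
    r′ (inj₂ (s , _)) with refl ← antisym linS p q r s = reflexive linT (U⇒T u)
  Diag-transfer (nleq a b) (u ∷ v ∷ []) (p , q , r) = U⇒T u , U⇒T v , r′ (same u v)
    where
    r′ : SameOrder S T a b → ¬ R T a b
    r′ (inj₁ (s , _)) _ = r s
    r′ (inj₂ (s , t)) t′ with refl ← antisym linT (U⇒T u) (U⇒T v) t′ t = r s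

  Diag-transfer-All : ∀ {α} → All U (concatMap numbers α) → All (Diag S) α → All (Diag T) α
  Diag-transfer-All {[]}    _ []       = []
  Diag-transfer-All {φ ∷ α} u (d ∷ ds) =
    Diag-transfer φ (All.++⁻ˡ (numbers φ) u) d ∷
    Diag-transfer-All (All.++⁻ʳ (numbers φ) u) ds

-- Finite chains, and sorting finite sets into chains.

Below : Copy → ℕ → ℕ → Set
Below S a b = R S a b × a ≢ b

Chain : Copy → List ℕ → Set
Chain S l = All (dom S) l × AllPairs (Below S) l

-- The position in the list fixes the order of two entries, in whichever copy the list is a chain.
Chain-same : ∀ {S T l} → LinearCopy S → LinearCopy T → Chain S l → Chain T l →
  ∀ {a b} → a ∈ l → b ∈ l → SameOrder S T a b
Chain-same linS linT (dS , pS) (dT , pT) a∈ b∈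
  with AllPairs-compare (AllPairs.zip (pS , pT)) a∈ b∈
... | inj₁ refl =
  inj₁ (reflexive linS (All.lookup dS a∈) , reflexive linT (All.lookup dT a∈))
... | inj₂ (inj₁ ((s , _) , (t , _))) = inj₁ (s , t)
... | inj₂ (inj₂ ((s , _) , (t , _))) = inj₂ (s , t)

-- The list `m` may run through entries of `l` in an order of its own; since S and T agree on `l`,
-- being increasing in S makes it increasing in T.
Chain-sub : ∀ {S T l m} → LinearCopy S → LinearCopy T → Chain S l → Chain T l →
  m ⊆ l → Chain S m → Chain T m
Chain-sub {S} {T} linS linT cS cT m⊆l (dm , pm) =
  All.tabulate (λ a∈ → All.lookup (proj₁ cT) (m⊆l a∈)) ,
  AllPairs-mapWith∈ step pm
  where
  step : ∀ {a b} → a ∈ _ → b ∈ _ → Below S a b → Below T a b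
  step a∈ b∈ (r , a≢b) with Chain-same {S} {T} linS linT cS cT (m⊆l a∈) (m⊆l b∈)
  ... | inj₁ (_ , t) = t , a≢b
  ... | inj₂ (s , _) =
    contradiction (antisym linS (All.lookup dm a∈) (All.lookup dm b∈) r s) a≢b

module _ {L : OrdStr} (lin : IsLinearOrder L) (_≟_ : (x y : Carrier L) → Dec (x ≡ y)) where
  open IsLinearOrder lin using () renaming (trans to ≼-trans; antisym to ≼-antisym; total to ≼-total)

  Strict-trans : ∀ {x y z} → Strict L x y → Strict L y z → Strict L x z
  Strict-trans (p , p≢) (q , _) = ≼-trans p q , λ { refl → p≢ (≼-antisym p q) }

  -- The bound on the entries of `l′` is what keeps the head below the result of the recursive call.
  insert : ∀ x {l} → AllPairs (Strict L) l →
    ∃ λ l′ → AllPairs (Strict L) l′ × (∀ {y} → y ∈ l′ → y ≡ x ⊎ y ∈ l) × (x ∷ l) ⊆ l′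
  insert x [] = x ∷ [] , [] ∷ [] , (λ { (here p) → inj₁ p }) , id
  insert x {a ∷ l} (p ∷ ps) with x ≟ a
  ... | yes refl = a ∷ l , p ∷ ps , inj₂ , λ { (here q) → here q ; (there q) → q }
  ... | no x≢a with ≼-total x a
  ...   | inj₁ x≼a = x ∷ a ∷ l , ((x≼a , x≢a) ∷ All.map (Strict-trans (x≼a , x≢a)) p) ∷ p ∷ ps ,
          (λ { (here q) → inj₁ q ; (there q) → inj₂ q }) , id
  ...   | inj₂ a≼x with l′ , ps′ , l′⊆ , ⊆l′ ← insert x ps =
          a ∷ l′ , All.tabulate below ∷ ps′ ,
          (λ { (here q) → inj₂ (here q) ; (there q) → [ inj₁ , inj₂ ∘ there ]′ (l′⊆ q) }) ,
          (λ { (here q) → there (⊆l′ (here q)) ; (there (here q)) → here q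
             ; (there (there q)) → there (⊆l′ (there q)) })
    where
    below : ∀ {y} → y ∈ l′ → Strict L a y
    below q with l′⊆ q
    ... | inj₁ refl = a≼x , x≢a ∘ sym
    ... | inj₂ y∈l  = All.lookup p y∈l

  sort : (l : List (Carrier L)) → ∃ λ l′ → AllPairs (Strict L) l′ × l ⊆ l′
  sort []      = [] , [] , id
  sort (x ∷ l) with l′ , ps , l⊆ ← sort l with l″ , ps′ , _ , ⊆l″ ← insert x ps =
    l″ , ps′ , λ { (here q) → ⊆l″ (here q) ; (there q) → ⊆l″ (there (l⊆ q)) }

  sortChain : ∀ {S} → Iso S L → ∀ {xs} → All (dom S) xs → ∃ λ l → Chain S l × xs ⊆ l
  sortChain {S} iso {xs} d with cs , ps , ⊆cs ← sort (All.reduce (Iso.f iso _) d) =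
    map num cs ,
    (All.map⁺ (All.tabulate (λ {c} _ → proj₁ (proj₂ (surj c)))) ,
     AllPairs.map⁺ (AllPairs.map below ps)) ,
    λ x∈ → subst (_∈ map num cs) (num-f _) (∈-map⁺ num (⊆cs (reduce∈ d x∈)))
    where
    open Iso iso
    num : Carrier L → ℕ
    num c = proj₁ (surj c)
    num-f : ∀ {x} (p : dom S x) → num (f x p) ≡ x
    num-f {x} p = inj _ p (proj₂ (proj₂ (surj (f x p))))
    below : ∀ {c d} → Strict L c d → Below S (num c) (num d)
    below {c} {d} (c≼d , c≢d) with surj c | surj d
    ... | n , p , refl | m , q , refl =
      -- `p` and `q` may be different proofs that one number lies in the domain; antisymmetry
      -- identifies their images.
      from (pres p q) c≼d , λ { refl →
        c≢d (≼-antisym c≼d (to (pres q p) (from (pres p q) c≼d))) }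
    reduce∈ : ∀ {xs} (d : All (dom S) xs) {x} (x∈ : x ∈ xs) →
      f x (All.lookup d x∈) ∈ All.reduce (f _) d
    reduce∈ (p ∷ _) (here refl) = here refl
    reduce∈ (_ ∷ d) (there x∈)  = there (reduce∈ d x∈)

-- Copies given by injective numberings.

copyOf : (L : OrdStr) → (Carrier L → ℕ) → Copy
copyOf L e = record
  { dom = λ x → ∃ λ c → e c ≡ x
  ; R   = λ x y → ∃ λ c → ∃ λ d → e c ≡ x × e d ≡ y × _≼_ L c d }

Injective : {A : Set} → (A → ℕ) → Set
Injective e = ∀ {c d} → e c ≡ e d → c ≡ d

copyOf-iso : ∀ {L e} → Injective e → Iso (copyOf L e) L
copyOf-iso {L} {e} e-inj = record
  { f    = λ _ → proj₁
  ; inj  = λ { (c , refl) (.c , refl) refl → refl }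
  ; surj = λ c → e c , (c , refl) , refl
  ; pres = λ { (c , refl) (d , refl) → mk⇔
      (λ { (c′ , d′ , p , q , r) → subst₂ (_≼_ L) (e-inj p) (e-inj q) r })
      (λ r → c , d , refl , refl , r) } }

Unique : List ℕ → Set
Unique = AllPairs _≢_

Chain-unique : ∀ {S l} → Chain S l → Unique l
Chain-unique (_ , ps) = AllPairs.map proj₂ ps

-- The index is one less than the number of copies of ω, so that there is always a first copy in
-- front of which elements can be added.
Cell : ℕ → Set
Cell k = Fin (suc k) × ℕ

code : ∀ {k} → Cell k → ℕ
code {k} (i , n) = toℕ i + n * suc k

-- The residue modulo `suc k` recovers the first coordinate; cancellation then gives the second.
code-injective : ∀ {k} → Injective (code {k})
code-injective {k} {i , n} {j , m} p = cong₂ _,_ i≡j (*-cancelʳ-≡ n m (suc k) q)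
  where
  residue : ∀ (i : Fin (suc k)) n → (toℕ i + n * suc k) % suc k ≡ toℕ i
  residue i n = ≡.trans ([m+kn]%n≡m%n (toℕ i) n (suc k)) (m<n⇒m%n≡m (Fin.toℕ<n i))
  i≡j : i ≡ j
  i≡j = Fin.toℕ-injective
    (≡.trans (sym (residue i n)) (≡.trans (cong (_% suc k) p) (residue j m)))
  q : n * suc k ≡ m * suc k
  q = +-cancelˡ-≡ (toℕ i) _ _ (≡.trans p (cong (λ j → toℕ j + m * suc k) (sym i≡j)))

-- Prepending finite lists to a copy of ω·(k+1).

module _ {k : ℕ} where

  -- This realises 1 + ω = ω in the first copy of ω: it vacates the least cell for one new element.
  shift : Cell k → Cell k
  shift (fzero , n)  = fzero , suc n
  shift (fsuc i , n) = fsuc i , n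

  prepend : ℕ → (Cell k → ℕ) → Cell k → ℕ
  prepend a e (fzero , zero)  = a
  prepend a e (fzero , suc n) = e (fzero , n)
  prepend a e (fsuc i , n)    = e (fsuc i , n)

  data View : Cell k → Set where
    first   : View (fzero , zero)
    shifted : ∀ c → View (shift c)

  view : ∀ c → View c
  view (fzero , zero)  = first
  view (fzero , suc n) = shifted (fzero , n)
  view (fsuc i , n)    = shifted (fsuc i , n)

  prepend-shift : ∀ a e c → prepend a e (shift c) ≡ e c
  prepend-shift a e (fzero , n)  = refl
  prepend-shift a e (fsuc i , n) = refl

  shift-mono : ∀ {c d} → _≼_ (ω· suc k) c d → _≼_ (ω· suc k) (shift c) (shift d)
  shift-mono {fzero , _}  {fzero , _}  (inj₂ (_ , p)) = inj₂ (refl , s≤s p)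
  shift-mono {fzero , _}  {fsuc _ , _} (inj₁ p)       = inj₁ p
  shift-mono {fsuc _ , _} {fzero , _}  (inj₁ ())
  shift-mono {fsuc _ , _} {fzero , _}  (inj₂ (() , _))
  shift-mono {fsuc _ , _} {fsuc _ , _} p              = p

  first-least : ∀ c → _≼_ (ω· suc k) (fzero , zero) c
  first-least (fzero , _)  = inj₂ (refl , z≤n)
  first-least (fsuc _ , _) = inj₁ (s≤s z≤n)

  ωcopy : (Cell k → ℕ) → Copy
  ωcopy = copyOf (ω· suc k)

  prepend-injective : ∀ {a e} → ¬ dom (ωcopy e) a → Injective e → Injective (prepend a e)
  prepend-injective {a} {e} a∉e e-inj {c} {d} p with view c | view d
  ... | first     | first     = refl
  ... | first     | shifted d = contradiction (d , sym (≡.trans p (prepend-shift a e d))) a∉e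
  ... | shifted c | first     = contradiction (c , ≡.trans (sym (prepend-shift a e c)) p) a∉e
  ... | shifted c | shifted d = cong shift
    (e-inj (≡.trans (sym (prepend-shift a e c)) (≡.trans p (prepend-shift a e d))))

  prepend-dom : ∀ {a e b} → dom (ωcopy e) b → dom (ωcopy (prepend a e)) b
  prepend-dom (c , p) = shift c , ≡.trans (prepend-shift _ _ c) p

  prepend-R : ∀ {a e b c} → R (ωcopy e) b c → R (ωcopy (prepend a e)) b c
  prepend-R (c , d , p , q , r) =
    shift c , shift d , ≡.trans (prepend-shift _ _ c) p , ≡.trans (prepend-shift _ _ d) q ,
    shift-mono r

  prepend-least : ∀ {a e b} → dom (ωcopy e) b → R (ωcopy (prepend a e)) a b
  prepend-least {a} {e} {b} d with c , p ← prepend-dom {a} {e} d =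
    (fzero , zero) , c , refl , p , first-least c

  prependAll : List ℕ → (Cell k → ℕ) → Cell k → ℕ
  prependAll l e = foldr prepend e l

  module _ (e : Cell k → ℕ) where

    prependAll-domˡ : ∀ {l a} → a ∈ l → dom (ωcopy (prependAll l e)) a
    prependAll-domˡ             (here refl) = (fzero , zero) , refl
    prependAll-domˡ {l = _ ∷ l} (there p)   = prepend-dom (prependAll-domˡ {l} p)

    prependAll-domʳ : ∀ l {a} → dom (ωcopy e) a → dom (ωcopy (prependAll l e)) a
    prependAll-domʳ []      p = p
    prependAll-domʳ (_ ∷ l) p = prepend-dom (prependAll-domʳ l p)

    prependAll-dom⁻ : ∀ l {a} → dom (ωcopy (prependAll l e)) a → a ∈ l ⊎ dom (ωcopy e) a
    prependAll-dom⁻ []      p = inj₂ p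
    prependAll-dom⁻ (b ∷ l) (c , p) with view c
    ... | first     = inj₁ (here (sym p))
    ... | shifted c with prependAll-dom⁻ l (c , ≡.trans (sym (prepend-shift b _ c)) p)
    ...   | inj₁ q = inj₁ (there q)
    ...   | inj₂ q = inj₂ q

    prependAll-injective : ∀ {l} → Unique l → All (λ a → ¬ dom (ωcopy e) a) l →
      Injective e → Injective (prependAll l e)
    prependAll-injective [] [] e-inj = e-inj
    prependAll-injective {a ∷ l} (u ∷ us) (f ∷ fs) e-inj =
      prepend-injective a∉ (prependAll-injective us fs e-inj)
      where
      a∉ : ¬ dom (ωcopy (prependAll l e)) a
      a∉ p with prependAll-dom⁻ l p
      ... | inj₁ a∈l = All.lookup u a∈l refl
      ... | inj₂ a∈e = f a∈e

    -- Elements in front are ordered as they are listed, so any duplicate-free list becomes a chain.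
    -- This is how a chain found in a copy of ω*·(k+1) is continued to a copy of ω·(k+1).
    prependAll-chain : ∀ {l} → Unique l → Chain (ωcopy (prependAll l e)) l
    prependAll-chain u = All.tabulate prependAll-domˡ , sorted u
      where
      sorted : ∀ {l} → Unique l → AllPairs (Below (ωcopy (prependAll l e))) l
      sorted []       = []
      sorted {_ ∷ l} (u ∷ us) =
        All.tabulate (λ b∈ → prepend-least (prependAll-domˡ {l} b∈) , All.lookup u b∈) ∷
        AllPairs.map (λ (p , q) → prepend-R p , q) (sorted us)

    prependAll-cross : ∀ {l a b} → a ∈ l → dom (ωcopy e) b → R (ωcopy (prependAll l e)) a b
    prependAll-cross {l = _ ∷ l} (here refl) p = prepend-least (prependAll-domʳ l p)
    prependAll-cross {l = _ ∷ l} (there q)   p = prepend-R (prependAll-cross {l} q p)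

    prependAll-R : ∀ l {a b} → R (ωcopy e) a b → R (ωcopy (prependAll l e)) a b
    prependAll-R []      p = p
    prependAll-R (_ ∷ l) p = prepend-R (prependAll-R l p)

    -- Two entries of `m` agree by the chain hypothesis, an entry of `m` lies below all of `e` on
    -- both sides, and the part given by `e` is the same on both sides.
    prependAll-same : ∀ {l m} →
      LinearCopy (ωcopy (prependAll m e)) → LinearCopy (ωcopy (prependAll l e)) →
      Unique m → Chain (ωcopy (prependAll l e)) m →
      ∀ {a b} → dom (ωcopy (prependAll m e)) a → dom (ωcopy (prependAll m e)) b →
      m ⊆ l → SameOrder (ωcopy (prependAll m e)) (ωcopy (prependAll l e)) a b
    prependAll-same {l} {m} linm linl u c p q m⊆l
      with prependAll-dom⁻ m p | prependAll-dom⁻ m q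
    ... | inj₁ a∈ | inj₁ b∈ = Chain-same linm linl (prependAll-chain u) c a∈ b∈
    ... | inj₁ a∈ | inj₂ b∈ = inj₁ (prependAll-cross a∈ b∈ , prependAll-cross (m⊆l a∈) b∈)
    ... | inj₂ a∈ | inj₁ b∈ = inj₂ (prependAll-cross b∈ a∈ , prependAll-cross (m⊆l b∈) a∈)
    ... | inj₂ (x , refl) | inj₂ (y , refl) with IsLinearOrder.total (ω-linear (suc k)) x y
    ...   | inj₁ x≼y = inj₁ (prependAll-R m r , prependAll-R l r)
      where r = x , y , refl , refl , x≼y
    ...   | inj₂ y≼x = inj₂ (prependAll-R m r , prependAll-R l r)
      where r = y , x , refl , refl , y≼x

-- Forcing by finite chains.

record Good (Γ : EnumOp) (S : Copy) : Set₁ where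
  field
    {source target} : OrdStr
    linear : IsLinearOrder source
    iso    : Iso S source
    output : IsDiagOfCopy (apply Γ S) target

  linearS : LinearCopy S
  linearS = linearCopy linear iso

module Forcing (dec : (P : Set) → Dec P) (Γ : EnumOp) {k : ℕ} {M : OrdStr}
               (witness : ∀ S → Iso S (ω· suc k) → IsDiagOfCopy (apply Γ S) M) where

  open Good using (linearS; output)

  -- Good copies of either source order are quantified over, so what is found in a copy of ω*·(k+1)
  -- can be used in copies of ω·(k+1).
  Forces : List ℕ → Sentence → Set₁
  Forces l φ = ∀ {T} → Good Γ T → Chain T l → apply Γ T φ

  -- An enumerated sentence uses only a finite `α`. Its numbers are sorted together with `m`, and a
  -- good copy having the result as a chain satisfies `α` too.
  compactness : ∀ {S φ m} → Good Γ S → All (dom S) m → apply Γ S φ →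
    ∃ λ l → Chain S l × m ⊆ l × Forces l φ
  compactness {S} {φ} {m} gS dm (s , α , enumerated , ds)
    with l , cS , xs⊆l ← sortChain (Good.linear gS) (λ _ _ → dec _) (Good.iso gS)
                           (All.++⁺ dm (Diag-dom-All ds)) =
    l , cS , xs⊆l ∘ ∈-++⁺ˡ , λ gT cT → s , α , enumerated ,
      Diag-transfer-All (linearS gS) (linearS gT) (All.lookup (proj₁ cT))
        (Chain-same (linearS gS) (linearS gT) cS cT)
        (All.tabulate (xs⊆l ∘ ∈-++⁺ʳ m)) ds

  apply-mono : ∀ {S T φ} → Good Γ S → Good Γ T → (∀ {a} → dom S a → dom T a) →
    (∀ {a b} → dom S a → dom S b → SameOrder S T a b) → apply Γ S φ → apply Γ T φ
  apply-mono {S} gS gT sub same (s , α , enumerated , ds) =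
    s , α , enumerated , Diag-transfer-All (linearS gS) (linearS gT) sub same (Diag-dom-All ds) ds

  output-compare : ∀ {S x y} → Good Γ S → apply Γ S (eq x x) → apply Γ S (eq y y) →
    apply Γ S (leq x y) ⊎ apply Γ S (nleq x y)
  output-compare {x = x} {y} gS p q with C , _ , diag ← output gS
    with dec (R C x y) | to (diag _) p | to (diag _) q
  ... | yes r | dx , _ | dy , _ = inj₁ (from (diag _) (dx , dy , r))
  ... | no ¬r | dx , _ | dy , _ = inj₂ (from (diag _) (dx , dy , ¬r))

  output-consistent : ∀ {S x y} → Good Γ S → apply Γ S (leq x y) → ¬ apply Γ S (nleq x y)
  output-consistent gS p q with C , _ , diag ← output gS
    with to (diag _) p | to (diag _) q
  ... | _ , _ , r | _ , _ , ¬r = ¬r r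

  module _ (N : ℕ) where

    fresh : Cell k → ℕ
    fresh c = N + code c

    fresh-injective : Injective fresh
    fresh-injective p = code-injective (+-cancelˡ-≡ N _ _ p)

    thenFresh : List ℕ → Copy
    thenFresh l = ωcopy (prependAll l fresh)

    thenFresh-good : ∀ {l} → Unique l → All (_< N) l → Good Γ (thenFresh l)
    thenFresh-good u l<N = record
      { linear = ω-linear (suc k) ; iso = i ; output = witness _ i }
      where
      i = copyOf-iso (prependAll-injective fresh u
            (All.map (λ { a<N (c , refl) → <⇒≱ a<N (m≤m+n N (code c)) }) l<N) fresh-injective)

    -- The same fresh elements follow both lists, so the continuation of `m` is a substructure of
    -- that of `l`. The copy S shows that the two lists order the entries of `m` alike.
    thenFresh-mono : ∀ {S l m φ} → Good Γ S → Chain S l → Chain S m → m ⊆ l →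
      All (_< N) l → apply Γ (thenFresh m) φ → apply Γ (thenFresh l) φ
    thenFresh-mono {l = l} {m} gS cl cm m⊆l l<N =
      apply-mono gm gl
        (λ p → [ prependAll-domˡ fresh ∘ m⊆l , prependAll-domʳ fresh l ]′
                 (prependAll-dom⁻ fresh m p))
        (λ p q → prependAll-same fresh (linearS gm) (linearS gl) um
          (Chain-sub (linearS gS) (linearS gl) cl (prependAll-chain fresh ul) m⊆l cm) p q m⊆l)
      where
      um = Chain-unique cm
      ul = Chain-unique cl
      gm = thenFresh-good um (All.tabulate (All.lookup l<N ∘ m⊆l))
      gl = thenFresh-good ul l<N

  -- The finite conditions deciding the sentence in S and in T may conflict with each
  -- other, but both are compatible with m followed by fresh elements.
  determined : ∀ {S T m x y} → Good Γ S → Good Γ T → Chain S m → Chain T m →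
    Forces m (eq x x) → Forces m (eq y y) → apply Γ S (leq x y) → apply Γ T (leq x y)
  determined {m = m} {x} {y} gS gT cS cT fx fy p
    with output-compare gT (fx gT cT) (fy gT cT)
  ... | inj₁ q = q
  ... | inj₂ q
    with l , cl , m⊆l , fl ← compactness gS (proj₁ cS) p
    with l′ , cl′ , m⊆l′ , fl′ ← compactness gT (proj₁ cT) q =
    [ (λ r → ⊥-elim (output-consistent g′ (thenFresh-mono N gT cl′ cT m⊆l′ l′<N r)
                       (fl′ g′ (prependAll-chain (fresh N) (Chain-unique cl′))))) ,
      (λ r → ⊥-elim (output-consistent g (fl g (prependAll-chain (fresh N) (Chain-unique cl)))
                       (thenFresh-mono N gS cl cS m⊆l l<N r))) ]′
      (output-compare gm (fx gm cm) (fy gm cm))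
    where
    -- Above all numbers in `l` and `l′`, so that one fresh part can follow each of `m`, `l` and
    -- `l′`.
    N    = suc (max 0 (l ++ l′))
    <N   = All.map s≤s (xs≤max 0 (l ++ l′))
    l<N  = All.++⁻ˡ l <N
    l′<N = All.++⁻ʳ l <N
    g    = thenFresh-good N (Chain-unique cl) l<N
    g′   = thenFresh-good N (Chain-unique cl′) l′<N
    gm   = thenFresh-good N (Chain-unique cS) (All.tabulate (All.lookup l<N ∘ m⊆l))
    cm   = prependAll-chain (fresh N) (Chain-unique cS)

-- Cutting ℕ into consecutive finite intervals.

module Flatten (t : ℕ → ℕ) where

  -- Here `t n` is the last index within the n-th interval, which has `suc (t n)` places and is
  -- never empty.
  offset : ℕ → ℕ
  offset zero    = 0
  offset (suc n) = offset n + suc (t n)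

  pos : ℕ → ℕ → ℕ
  pos n r = offset n + r

  offset-mono : ∀ {n m} → n ≤ m → offset n ≤ offset m
  offset-mono {m = zero}  z≤n = z≤n
  offset-mono {m = suc m} p with m≤n⇒m<n∨m≡n p
  ... | inj₁ (s≤s q) = ≤-trans (offset-mono q) (m≤m+n (offset m) _)
  ... | inj₂ refl    = ≤-refl

  pos-mono-< : ∀ {n m r} → r ≤ t n → n < m → ∀ s → pos n r < pos m s
  pos-mono-< {n} {m} {r} r≤ n<m s = begin-strict
    offset n + r         <⟨ +-monoʳ-< (offset n) (s≤s r≤) ⟩
    offset (suc n)       ≤⟨ offset-mono n<m ⟩
    offset m             ≤⟨ m≤m+n (offset m) s ⟩
    offset m + s         ∎
    where open ≤-Reasoning

  pos-injective : ∀ {n m r s} → r ≤ t n → s ≤ t m → pos n r ≡ pos m s → n ≡ m × r ≡ s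
  pos-injective {n} {m} {r} {s} r≤ s≤ p with <-cmp n m
  ... | tri< n<m _ _  = ⊥-elim (<-irrefl p (pos-mono-< r≤ n<m s))
  ... | tri≈ _ refl _ = refl , +-cancelˡ-≡ (offset n) _ _ p
  ... | tri> _ _ m<n  = ⊥-elim (<-irrefl (sym p) (pos-mono-< s≤ m<n r))

  decode : ∀ i → ∃ λ n → ∃ λ r → r ≤ t n × pos n r ≡ i
  decode zero = 0 , 0 , z≤n , refl
  decode (suc i) with n , r , r≤ , p ← decode i with m≤n⇒m<n∨m≡n r≤
  ... | inj₁ r<  = n , suc r , r< , ≡.trans (+-suc (offset n) r) (cong suc p)
  ... | inj₂ r≡t = suc n , 0 , z≤n , (begin
    offset n + suc (t n) + 0  ≡⟨ +-identityʳ _ ⟩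
    offset n + suc (t n)      ≡⟨ +-suc (offset n) (t n) ⟩
    suc (offset n + t n)      ≡⟨ cong (λ r → suc (offset n + r)) r≡t ⟨
    suc (offset n + r)        ≡⟨ cong suc p ⟩
    suc i                    ∎)
    where open ≡-Reasoning

-- Arranging finite blocks in type ω·(k+1) or ω*·(k+1).

module Arrange (t : ℕ → ℕ) (b : ℕ → ℕ → ℕ)
  (b-injective : ∀ {i j r s} → r ≤ t i → s ≤ t j → b i r ≡ b j s → i ≡ j × r ≡ s) where

  block : ℕ → List ℕ
  block j = applyUpTo (b j) (suc (t j))

  -- The block `g c` takes the place of the point `c`. For sums of ω or of ω*, replacing points by
  -- nonempty finite chains leaves the order type unchanged, so the result can still be a copy of L.
  record Arrangement (L : OrdStr) (g : Carrier L → ℕ) : Set₁ where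
    field
      copy   : Copy
      iso    : Iso copy L
      chain  : ∀ c → Chain copy (block (g c))
      chains : ∀ {c d} → Strict L c d → Chain copy (block (g c) ++ block (g d))

  -- `q c r` is the place given to entry `r` of the block at `c`. Weak inequalities between places
  -- suffice, as `b-injective` keeps the entries distinct.
  arrangement : ∀ {L e} {g : Carrier L → ℕ} → Injective e → Injective g →
    (q : Carrier L → ℕ → Carrier L) →
    (∀ c {r} → r ≤ t (g c) → e (q c r) ≡ b (g c) r) →
    (∀ c {r s} → r < s → _≼_ L (q c r) (q c s)) →
    (∀ {c d r s} → Strict L c d → r ≤ t (g c) → s ≤ t (g d) → _≼_ L (q c r) (q d s)) →
    Arrangement L g
  arrangement {L} {e} {g} e-inj g-inj q e-q within across = record
    { copy   = copyOf L e
    ; iso    = copyOf-iso e-inj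
    ; chain  = λ c → blockDom c , blockPairs c
    ; chains = λ {c} {d} c≺d →
        All.++⁺ (blockDom c) (blockDom d) ,
        AllPairs.++⁺ (blockPairs c) (blockPairs d)
          (All.applyUpTo⁺₁ (b (g c)) (suc (t (g c))) λ { {r} (s≤s r≤) →
             All.applyUpTo⁺₁ (b (g d)) (suc (t (g d))) λ { {s} (s≤s s≤) →
               (q c r , q d s , e-q c r≤ , e-q d s≤ , across c≺d r≤ s≤) ,
               (λ p → proj₂ c≺d (g-inj (proj₁ (b-injective r≤ s≤ p)))) } }) }
    where
    blockDom : ∀ c → All (dom (copyOf L e)) (block (g c))
    blockDom c = All.applyUpTo⁺₁ (b (g c)) (suc (t (g c))) λ { {r} (s≤s r≤) → q c r , e-q c r≤ }
    blockPairs : ∀ c → AllPairs (Below (copyOf L e)) (block (g c))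
    blockPairs c = AllPairs.applyUpTo⁺₁ (b (g c)) (suc (t (g c))) λ { {r} {s} r<s (s≤s s≤) →
      (q c r , q c s , e-q c (≤-trans (<⇒≤ r<s) s≤) , e-q c s≤ , within c r<s) ,
      λ p → <-irrefl (proj₂ (b-injective (≤-trans (<⇒≤ r<s) s≤) s≤ p)) r<s }

  module _ {k} (g : Cell k → ℕ) (g-inj : Injective g) where

    private
      module F (i : Fin (suc k)) = Flatten (λ n → t (g (i , n)))

    -- The entries are a parameter `v`, so that blocks can also be filled in backwards.
    place : (ℕ → ℕ → ℕ) → Cell k → ℕ
    place v (i , m) = v (g (i , proj₁ (F.decode i m))) (proj₁ (proj₂ (F.decode i m)))

    module _ {v : ℕ → ℕ → ℕ}
      (v-injective : ∀ {i j r s} → r ≤ t i → s ≤ t j → v i r ≡ v j s → i ≡ j × r ≡ s) where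

      place-injective : Injective (place v)
      place-injective {i , m} {j , m′} p
        with n , r , r≤ , refl ← F.decode i m | n′ , r′ , r′≤ , refl ← F.decode j m′
        with v-injective r≤ r′≤ p
      ... | g≡ , refl with refl ← g-inj g≡ = refl

    place-pos : ∀ v i n {r} → r ≤ t (g (i , n)) → place v (i , F.pos i n r) ≡ v (g (i , n)) r
    place-pos v i n {r} r≤ with n′ , r′ , r′≤ , p ← F.decode i (F.pos i n r)
      with refl , refl ← F.pos-injective i r′≤ r≤ p = refl

    ω-arrangement : Arrangement (ω· suc k) g
    ω-arrangement = arrangement (place-injective b-injective) g-inj
      (λ (i , n) r → i , F.pos i n r)
      (λ (i , n) → place-pos b i n)
      (λ (i , n) r<s → inj₂ (refl , +-monoʳ-≤ (F.offset i n) (<⇒≤ r<s)))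
      λ { (inj₁ p , _) _ _ → inj₁ p
        ; {i , n} {_ , m} (inj₂ (refl , n≤m) , ≢) r≤ _ →
            inj₂ (refl , <⇒≤ (F.pos-mono-< i r≤ (≤∧≢⇒< n≤m (≢ ∘ cong (i ,_))) _)) }

    -- In a copy of ω* a larger index lies lower, so each block is entered backwards in order to be
    -- increasing as listed.
    ω*-arrangement : Arrangement (ω*· suc k) g
    ω*-arrangement = arrangement (place-injective {rev} rev-injective) g-inj
      (λ (i , n) r → i , F.pos i n (t (g (i , n)) ∸ r))
      (λ (i , n) {r} r≤ → ≡.trans (place-pos rev i n (m∸n≤m (t (g (i , n))) r))
                              (cong (b (g (i , n))) (m∸[m∸n]≡n r≤)))
      (λ (i , n) r<s → inj₂ (refl ,
         +-monoʳ-≤ (F.offset i n) (∸-monoʳ-≤ (t (g (i , n))) (<⇒≤ r<s))))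
      λ { (inj₁ p , _) _ _ → inj₁ p
        ; {i , n} {_ , m} {_} {s} (inj₂ (refl , m≤n) , ≢) _ _ →
            inj₂ (refl , <⇒≤ (F.pos-mono-< i (m∸n≤m (t (g (i , m))) s)
              (≤∧≢⇒< m≤n (≢ ∘ cong (i ,_) ∘ sym)) _)) }
      where
      rev : ℕ → ℕ → ℕ
      rev j r = b j (t j ∸ r)
      rev-injective : ∀ {i j r s} → r ≤ t i → s ≤ t j → rev i r ≡ rev j s → i ≡ j × r ≡ s
      rev-injective {i} {j} {r} {s} r≤ s≤ p
        with refl , q ← b-injective (m∸n≤m (t i) r) (m∸n≤m (t j) s) p =
        refl , ∸-cancelˡ-≡ r≤ s≤ q

-- Monotone subsequences, and new elements in copies of infinite orders.

module _ (dec : (P : Set) → Dec P) where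

  module _ {D : OrdStr} (linD : IsLinearOrder D) (wf : NoInfDesc D) (y : ℕ → Carrier D) where

    -- If no value of the tail were least, each could be followed by a strictly smaller one, giving
    -- an infinite descending chain.
    least-from : ∀ N → ∃ λ m → N ≤ m × (∀ n → N ≤ n → _≼_ D (y m) (y n))
    least-from N with dec (∃ λ m → N ≤ m × (∀ n → N ≤ n → _≼_ D (y m) (y n)))
    ... | yes p = p
    ... | no ¬p = ⊥-elim (wf (y ∘ proj₁ ∘ descent , λ n → proj₂ (smaller (descent n))))
      where
      smaller : (s : ∃ (N ≤_)) → ∃ λ (s′ : ∃ (N ≤_)) → Strict D (y (proj₁ s′)) (y (proj₁ s))
      smaller (m , N≤m)
        with dec (∃ λ (s′ : ∃ (N ≤_)) → Strict D (y (proj₁ s′)) (y m))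
      ... | yes q = q
      ... | no ¬q = ⊥-elim (¬p (m , N≤m , λ n N≤n → decidable-stable (dec _) λ m⋠n →
        ¬q ((n , N≤n) ,
          [ (λ r → ⊥-elim (m⋠n r)) , id ]′ (IsLinearOrder.total linD (y m) (y n)) ,
          λ e → m⋠n (subst (_≼_ D (y m)) (sym e) (IsLinearOrder.reflexive linD (y m))))))
      descent : ℕ → ∃ (N ≤_)
      descent zero    = N , ≤-refl
      descent (suc n) = proj₁ (smaller (descent n))

    -- Each term is a least value of the tail beginning after the previous choice, hence at most
    -- every later term.
    monotone-subsequence : ∃ λ (s : ℕ → ℕ) →
      (∀ {i j} → i < j → s i < s j) × (∀ {i j} → i < j → _≼_ D (y (s i)) (y (s j)))
    monotone-subsequence = s , s-< , λ {i} i<j → least i _ (<⇒≤ (s-< i<j))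
      where
      s : ℕ → ℕ
      s zero    = proj₁ (least-from 0)
      s (suc i) = proj₁ (least-from (suc (s i)))
      least : ∀ i n → s i ≤ n → _≼_ D (y (s i)) (y n)
      least zero    n p = proj₂ (proj₂ (least-from 0)) n z≤n
      least (suc i) n p with _ , q , r ← least-from (suc (s i)) = r n (≤-trans q p)
      s-< : ∀ {i j} → i < j → s i < s j
      s-< {i} {suc j} (s≤s i≤j) with m≤n⇒m<n∨m≡n i≤j
      ... | inj₁ i<j  = <-trans (s-< i<j) (proj₁ (proj₂ (least-from (suc (s j)))))
      ... | inj₂ refl = proj₁ (proj₂ (least-from (suc (s j))))

  -- Were the domain covered by the list `X`, the images of `X` would list all of D.
  infinite-copy : ∀ {D C} → IsLinearOrder D → Infinite D → Iso C D →
    ∀ X → ∃ λ x → dom C x × ¬ x ∈ X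
  infinite-copy {D} {C} linD inf iso X with dec (∃ λ x → dom C x × ¬ x ∈ X)
  ... | yes p = p
  ... | no ¬p = ⊥-elim (inf (images X , all))
    where
    open Iso iso
    images : List ℕ → List (Carrier D)
    images [] = []
    images (x ∷ X) with dec (dom C x)
    ... | yes p = f x p ∷ images X
    ... | no _  = images X
    -- Domain proofs need not be unique, but the relation holds between a number and itself
    -- whichever proofs are used.
    f-irrelevant : ∀ {x} (p q : dom C x) → f x p ≡ f x q
    f-irrelevant p q = IsLinearOrder.antisym linD (to (pres p q) r) (to (pres q p) r)
      where r = from (pres p p) (IsLinearOrder.reflexive linD _)
    f∈images : ∀ {X x} (p : dom C x) → x ∈ X → f x p ∈ images X
    f∈images {x ∷ X} p (here refl) with dec (dom C x)
    ... | yes q = here (f-irrelevant p q)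
    ... | no ¬q = contradiction p ¬q
    f∈images {x ∷ X} p (there x∈) with dec (dom C x)
    ... | yes _ = there (f∈images p x∈)
    ... | no _  = f∈images p x∈
    all : ∀ c → c ∈ images X
    all c with x , p , refl ← surj c =
      f∈images p (decidable-stable (dec _) λ x∉ → ¬p (x , p , x∉))

-- Splitting and indexing lists.

AllPairs-++⁻ˡ : ∀ {A : Set} {P : A → A → Set} l {m} → AllPairs P (l ++ m) → AllPairs P l
AllPairs-++⁻ˡ []      _        = []
AllPairs-++⁻ˡ (a ∷ l) (p ∷ ps) = All.++⁻ˡ l p ∷ AllPairs-++⁻ˡ l ps

AllPairs-++⁻ʳ : ∀ {A : Set} {P : A → A → Set} l {m} → AllPairs P (l ++ m) → AllPairs P m
AllPairs-++⁻ʳ []      ps       = ps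
AllPairs-++⁻ʳ (a ∷ l) (_ ∷ ps) = AllPairs-++⁻ʳ l ps

AllPairs-applyUpTo⁻ : ∀ {A : Set} {P : A → A → Set} f n → AllPairs P (applyUpTo f n) →
  ∀ {i j} → i < j → j < n → P (f i) (f j)
AllPairs-applyUpTo⁻ f (suc n) (p ∷ _)  {zero}  {suc j} _         (s≤s j<n) =
  All.applyUpTo⁻ (f ∘ suc) n p j<n
AllPairs-applyUpTo⁻ f (suc n) (_ ∷ ps) {suc i} {suc j} (s≤s i<j) (s≤s j<n) =
  AllPairs-applyUpTo⁻ (f ∘ suc) n ps i<j j<n

-- The default 0 is read only past the end of the list.
nth : List ℕ → ℕ → ℕ
nth []      _       = 0
nth (a ∷ l) zero    = a
nth (a ∷ l) (suc r) = nth l r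

applyUpTo-nth : ∀ l → applyUpTo (nth l) (length l) ≡ l
applyUpTo-nth []      = refl
applyUpTo-nth (a ∷ l) = cong (a ∷_) (applyUpTo-nth l)

-- Disjoint blocks forcing distinct outputs.

module Blocks (dec : (P : Set) → Dec P) (k : ℕ) (Γ : EnumOp) {D₀ D₁ : OrdStr}
  (lin₁ : IsLinearOrder D₁) (inf : Infinite D₁)
  (witness₀ : ∀ S → Iso S (ω· suc k) → IsDiagOfCopy (apply Γ S) D₀)
  (witness₁ : ∀ S → Iso S (ω*· suc k) → IsDiagOfCopy (apply Γ S) D₁) where

  open Forcing dec Γ witness₀

  -- `N` bounds the elements and `X` lists the outputs already used by earlier blocks.
  record Block (N : ℕ) (X : List ℕ) : Set₁ where
    field
      last out : ℕ
      elt      : ℕ → ℕ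
    elts = applyUpTo elt (suc last)
    field
      unique : Unique elts
      above  : All (N ≤_) elts
      new    : ¬ out ∈ X
      forces : Forces elts (eq out out)

  abstract
    -- On a copy of ω*·(k+1) using only numbers from `N` on, Γ outputs a copy of the infinite D₁.
    -- This has an element outside `X`, and a finite chain forces it.
    next : ∀ N X → Block N X
    next N X
      with C , isoC , diag ← witness₁ _ (copyOf-iso (fresh-injective N))
      with x , dx , x∉X ← infinite-copy dec lin₁ inf isoC X
      with l , cl , m⊆l , fl ← compactness
             (record { linear = ω*-linear (suc k) ; iso = copyOf-iso (fresh-injective N)
                     ; output = C , isoC , diag })
             -- One arbitrary element is put into the chain to make it nonempty.
             (((fzero , 0) , refl) ∷ []) (from (diag (eq x x)) (dx , dx , refl))
      = block l cl (m⊆l (here refl)) fl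
      where
      block : ∀ l → Chain (copyOf (ω*· suc k) (fresh N)) l → ∀ {a} → a ∈ l →
        Forces l (eq x x) → Block N X
      block (a ∷ l) cl _ fl = record
        { last   = length l
        ; out    = x
        ; elt    = nth (a ∷ l)
        ; unique = subst Unique (sym e) (Chain-unique cl)
        ; above  = subst (All (N ≤_)) (sym e)
                     (All.map (λ { (c , refl) → m≤m+n N (code c) }) (proj₁ cl))
        ; new    = x∉X
        ; forces = subst (λ l → Forces l (eq x x)) (sym e) fl }
        where
        e : applyUpTo (nth (a ∷ l)) (suc (length l)) ≡ a ∷ l
        e = applyUpTo-nth (a ∷ l)

  bound : ℕ → ℕ
  outs  : ℕ → List ℕ
  blk   : ∀ j → Block (bound j) (outs j)

  bound zero    = 0
  bound (suc j) = suc (max 0 (Block.elts (blk j)))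
  outs zero     = []
  outs (suc j)  = Block.out (blk j) ∷ outs j
  blk j = next (bound j) (outs j)

  x : ℕ → ℕ
  x j = Block.out (blk j)
  t : ℕ → ℕ
  t j = Block.last (blk j)
  b : ℕ → ℕ → ℕ
  b j = Block.elt (blk j)

  bound≤b : ∀ j {r} → r ≤ t j → bound j ≤ b j r
  bound≤b j r≤ = All.applyUpTo⁻ (b j) (suc (t j)) (Block.above (blk j)) (s≤s r≤)

  b<bound : ∀ j {r} → r ≤ t j → b j r < bound (suc j)
  b<bound j r≤ = s≤s (All.applyUpTo⁻ (b j) (suc (t j)) (xs≤max 0 (Block.elts (blk j))) (s≤s r≤))

  earlier : ∀ {i j} → i < j → x i ∈ outs j × (∀ {r} → r ≤ t i → b i r < bound j)
  earlier {i} {suc j} (s≤s i≤j) with m≤n⇒m<n∨m≡n i≤j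
  ... | inj₂ refl = here refl , b<bound j
  ... | inj₁ i<j with p , q ← earlier i<j = there p , λ r≤ →
    -- The bounds increase strictly, as entry 0 of block `j` lies between two consecutive ones.
    <-trans (q r≤) (≤-<-trans (bound≤b j {0} z≤n) (b<bound j {0} z≤n))

  x-injective : ∀ {i j} → x i ≡ x j → i ≡ j
  x-injective {i} {j} p with <-cmp i j
  ... | tri< i<j _ _ = contradiction (subst (_∈ outs j) p (proj₁ (earlier i<j))) (Block.new (blk j))
  ... | tri≈ _ i≡j _ = i≡j
  ... | tri> _ _ j<i =
    contradiction (subst (_∈ outs i) (sym p) (proj₁ (earlier j<i))) (Block.new (blk i))

  -- Different blocks occupy disjoint ranges of numbers; inside one block the entries are unique.
  b-injective : ∀ {i j r s} → r ≤ t i → s ≤ t j → b i r ≡ b j s → i ≡ j × r ≡ s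
  b-injective {i} {j} {r} {s} r≤ s≤ p with <-cmp i j
  ... | tri< i<j _ _ =
    ⊥-elim (<-irrefl p (<-≤-trans (proj₂ (earlier i<j) r≤) (bound≤b j s≤)))
  ... | tri> _ _ j<i =
    ⊥-elim (<-irrefl (sym p) (<-≤-trans (proj₂ (earlier j<i) s≤) (bound≤b i r≤)))
  ... | tri≈ _ refl _ with <-cmp r s
  ...   | tri≈ _ r≡s _ = refl , r≡s
  ...   | tri< r<s _ _ =
    contradiction p (AllPairs-applyUpTo⁻ (b i) (suc (t i)) (Block.unique (blk i)) r<s (s≤s s≤))
  ...   | tri> _ _ s<r =
    contradiction (sym p) (AllPairs-applyUpTo⁻ (b i) (suc (t i)) (Block.unique (blk i)) s<r (s≤s r≤))

-- Thinning out the blocks, and the two embeddings.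

module Main (dec : (P : Set) → Dec P) (k : ℕ) (Γ : EnumOp) (D₀ D₁ : OrdStr)
  (lin₀ : IsLinearOrder D₀) (noDesc : NoInfDesc D₀)
  (lin₁ : IsLinearOrder D₁) (noAsc : NoInfAsc D₁)
  (witness₀ : ∀ S → Iso S (ω· suc k) → IsDiagOfCopy (apply Γ S) D₀)
  (witness₁ : ∀ S → Iso S (ω*· suc k) → IsDiagOfCopy (apply Γ S) D₁)
  (x t : ℕ → ℕ) (b : ℕ → ℕ → ℕ) (x-injective : Injective x)
  (b-injective : ∀ {i j r s} → r ≤ t i → s ≤ t j → b i r ≡ b j s → i ≡ j × r ≡ s)
  (block-forces : ∀ j → Forcing.Forces dec Γ witness₀
                    (applyUpTo (b j) (suc (t j))) (eq (x j) (x j))) where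

  open Forcing dec Γ witness₀

  open Arrange t b b-injective

  forcesˡ : ∀ i j → Forces (block i ++ block j) (eq (x i) (x i))
  forcesˡ i j gT (d , ps) =
    block-forces i gT (All.++⁻ˡ (block i) d , AllPairs-++⁻ˡ (block i) ps)

  forcesʳ : ∀ i j → Forces (block i ++ block j) (eq (x j) (x j))
  forcesʳ i j gT (d , ps) =
    block-forces j gT (All.++⁻ʳ (block i) d , AllPairs-++⁻ʳ (block i) ps)

  Respects : ℕ → ℕ → Set₁
  Respects i j = Forces (block i ++ block j) (leq (x i) (x j))

  module Output {L D : OrdStr} (linL : IsLinearOrder L) (linD : IsLinearOrder D)
    (witness : ∀ S → Iso S L → IsDiagOfCopy (apply Γ S) D)
    {g : Carrier L → ℕ} (A : Arrangement L g) where

    open Arrangement A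

    good : Good Γ copy
    good = record { linear = linL ; iso = iso ; output = witness copy iso }

    private
      C = proj₁ (witness copy iso)
      isoD = proj₁ (proj₂ (witness copy iso))
      diag = proj₂ (proj₂ (witness copy iso))

    x-dom : ∀ c → dom C (x (g c))
    x-dom c = proj₁ (to (diag (eq _ _)) (block-forces (g c) good (chain c)))

    y : Carrier L → Carrier D
    y c = Iso.f isoD (x (g c)) (x-dom c)

    -- The two blocks together force both outputs to exist, so by `determined` the order seen in
    -- this single copy holds in every good copy where the blocks stand in this order.
    respects : ∀ {c d} → Strict L c d → _≼_ D (y c) (y d) → Respects (g c) (g d)
    respects {c} {d} c≺d p gT cT =
      determined good gT (chains c≺d) cT (forcesˡ (g c) (g d)) (forcesʳ (g c) (g d))
        (from (diag _) (x-dom c , x-dom d , from (Iso.pres isoD (x-dom c) (x-dom d)) p))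

    embedding : Injective g → (∀ {c d} → c ≢ d → Respects (g c) (g d)) → Embeds L D
    embedding g-inj resp = y , λ c d → mk⇔ mono (reflects c d)
      where
      mono : ∀ {c d} → _≼_ L c d → _≼_ D (y c) (y d)
      mono {c} {d} c≼d with dec (c ≡ d)
      ... | yes refl = IsLinearOrder.reflexive linD (y c)
      ... | no c≢d   = to (Iso.pres isoD (x-dom c) (x-dom d))
        (proj₂ (proj₂ (to (diag (leq _ _)) (resp c≢d good (chains (c≼d , c≢d))))))
      reflects : ∀ c d → _≼_ D (y c) (y d) → _≼_ L c d
      reflects c d p with IsLinearOrder.total linL c d
      ... | inj₁ c≼d = c≼d
      ... | inj₂ d≼c
        -- Monotonicity makes the two outputs equal, and distinct points of L have distinct outputs.
        with refl ← g-inj (x-injective (Iso.inj isoD (x-dom c) (x-dom d)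
               (IsLinearOrder.antisym linD p (mono d≼c)))) = d≼c

  -- The first summand ω or ω* alone already provides the sequence to be thinned out.
  column : ℕ → Cell k
  column n = fzero , n

  code-column-mono : ∀ {n m} → n < m → code (column n) < code (column m)
  code-column-mono = *-monoˡ-< (suc k)

  increasing-injective : ∀ {a : ℕ → ℕ} → (∀ {i j} → i < j → a i < a j) → Injective a
  increasing-injective a-< {i} {j} p with <-cmp i j
  ... | tri< i<j _ _ = ⊥-elim (<-irrefl p (a-< i<j))
  ... | tri≈ _ i≡j _ = i≡j
  ... | tri> _ _ j<i = ⊥-elim (<-irrefl (sym p) (a-< j<i))

  private
    module Ascending = Output (ω-linear (suc k)) lin₀ witness₀ (ω-arrangement code code-injective)

  -- All blocks are arranged in type ω·(k+1); the outputs along the first ω have a monotone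
  -- subsequence in D₀.
  ascending : ∃ λ (a : ℕ → ℕ) → (∀ {i j} → i < j → a i < a j) ×
    (∀ {i j} → i < j → Respects (a i) (a j))
  ascending with s , s-< , s-≼ ← monotone-subsequence dec lin₀ noDesc (Ascending.y ∘ column) =
    code ∘ column ∘ s , code-column-mono ∘ s-< ,
    λ i<j → Ascending.respects
      (inj₂ (refl , <⇒≤ (s-< i<j)) , <⇒≢ (s-< i<j) ∘ cong proj₂) (s-≼ i<j)

  module _ (a : ℕ → ℕ) (a-< : ∀ {i j} → i < j → a i < a j) where

    private
      module Descending = Output (ω*-linear (suc k)) lin₁ witness₁
        (ω*-arrangement (a ∘ code) (code-injective ∘ increasing-injective a-<))

    -- In ω* later cells lie lower, and the reverse of D₁ has no infinite descending chains. So
    -- along a subsequence later outputs lie lower too.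
    descending : ∃ λ (s : ℕ → ℕ) → (∀ {i j} → i < j → s i < s j) ×
      (∀ {i j} → i < j → Respects (a (code (column (s j)))) (a (code (column (s i)))))
    descending = proj₁ sub , proj₁ (proj₂ sub) , λ i<j → Descending.respects
      (inj₂ (refl , <⇒≤ (s-< i<j)) , <⇒≢ (s-< i<j) ∘ sym ∘ cong proj₂) (proj₂ (proj₂ sub) i<j)
      where
      sub = monotone-subsequence dec (dual-linear lin₁)
        (λ (f , p) → noAsc (f , λ n → proj₁ (p n) , proj₂ (p n) ∘ sym)) (Descending.y ∘ column)
      s-< = proj₁ (proj₂ sub)

  module _ (a : ℕ → ℕ) (a-injective : Injective a)
           (a-respects : ∀ {i j} → i ≢ j → Respects (a i) (a j)) where

    g-injective : Injective (a ∘ code {k})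
    g-injective p = code-injective (a-injective p)

    -- Blocks related in both directions may be put in any order, and their outputs follow it.
    embeds : Embeds (ω· suc k) D₀ × Embeds (ω*· suc k) D₁
    embeds =
      Output.embedding (ω-linear (suc k)) lin₀ witness₀ (ω-arrangement (a ∘ code) g-injective)
        g-injective (λ c≢d → a-respects (c≢d ∘ code-injective)) ,
      Output.embedding (ω*-linear (suc k)) lin₁ witness₁ (ω*-arrangement (a ∘ code) g-injective)
        g-injective (λ c≢d → a-respects (c≢d ∘ code-injective))

  embeddings : Embeds (ω· suc k) D₀ × Embeds (ω*· suc k) D₁
  embeddings = fromAscending ascending
    where
    fromAscending : (∃ λ (a : ℕ → ℕ) → (∀ {i j} → i < j → a i < a j) ×
      (∀ {i j} → i < j → Respects (a i) (a j))) → Embeds (ω· suc k) D₀ × Embeds (ω*· suc k) D₁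
    fromAscending (a , a-< , up) = fromDescending (descending a a-<)
      where
      fromDescending : (∃ λ (s : ℕ → ℕ) → (∀ {i j} → i < j → s i < s j) ×
        (∀ {i j} → i < j → Respects (a (code (column (s j)))) (a (code (column (s i)))))) →
        Embeds (ω· suc k) D₀ × Embeds (ω*· suc k) D₁
      fromDescending (s , s-< , down) =
        embeds a′ (increasing-injective (a-< ∘ code-column-mono ∘ s-<)) both
        where
        a′ = a ∘ code ∘ column ∘ s
        both : ∀ {i j} → i ≢ j → Respects (a′ i) (a′ j)
        both {i} {j} i≢j with <-cmp i j
        -- The second thinning passes to a subsequence of the first, so the ascending relations
        -- survive.
        ... | tri< i<j _ _ = up (code-column-mono (s-< i<j))
        ... | tri≈ _ i≡j _ = contradiction i≡j i≢j
        ... | tri> _ _ j<i = down j<i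

theorem5p10 : ExcludedMiddle (lsuc 0ℓ) →
    (k : ℕ) → 2 ≤ k →
    (Γ : EnumOp) (D₀ D₁ : OrdStr) →
    IsLinearOrder D₀ → NoInfDesc D₀ →
    IsLinearOrder D₁ → Infinite D₁ → NoInfAsc D₁ →
    Witnesses Γ (ω· k) (ω*· k) D₀ D₁ →
    Embeds (ω· k) D₀ × Embeds (ω*· k) D₁
theorem5p10 em (suc k) _ Γ D₀ D₁ lin₀ noDesc lin₁ inf noAsc (w₀ , w₁) =
  Main.embeddings dec k Γ D₀ D₁ lin₀ noDesc lin₁ noAsc w₀ w₁
    x t b x-injective b-injective (λ j → Block.forces (blk j))
  where
  dec : (P : Set) → Dec P
  dec P = map′ lower lift (em {Lift (lsuc 0ℓ) P})
  open Blocks dec k Γ lin₁ inf w₀ w₁
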